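{- If $G$ is a connected outerplanar graph, then ${\rm col}_{\rm cg}(G)\le 5$, where ${\rm col}_{\rm cg}(G)$ denotes the connected game coloring number of $G$.
   Context: All graphs are finite, nonempty, undirected, simple and have no loops. An outerplanar graph is a graph that can be embedded in the plane in such a way that there are no edge crossings and all its vertices lie on the outer face; equivalently, a graph that contains neither $K_4$ nor $K_{2,3}$ as a minor. Connected graph marking game: given a connected graph $G$, two players, Alice and Bob, alternate turns, Alice having the first move. Initially all vertices are unmarked. On their turn, the player marks an unmarked vertex of $G$ which, except for Alice's very first move (for which she may choose any vertex), must have at least one already marked neighbor; equivalently, after each turn the subgraph induced by the set of marked vertices is connected. The game ends when all vertices are marked. The connected game coloring number ${\rm col}_{\rm cg}(G)$ of a connected graph $G$ is the smallest integer $k$ for which Alice has a strategy such that, when playing the connected graph marking game on $G$, at every step of the game every unmarked vertex has at most $k-1$ marked neighbors, whatever Bob's moves are. -}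

module Defs where

open import Data.Bool.Base using (Bool)
import Data.Bool.Properties as Bool
open import Data.Empty using (⊥-elim)
open import Data.Fin.Base using (Fin; toℕ)
import Data.Fin.Properties as Fin
open import Data.Fin.Subset
  using (Subset; _∈_; _∉_; _∪_; _∩_; _⊂_; ⁅_⁆; ∣_∣; ⊥; Nonempty; Empty)
open import Data.Fin.Subset.Properties
  using (_∈?_; nonempty?; p⊆p∪q; q⊆p∪q; x∈⁅x⁆; p⊂q⇒∣p∣<∣q∣; ∣p∣≤n; ∣p∣≡n⇒p≡⊤; ∈⊤)
open import Data.Nat.Base using (ℕ; zero; suc; _+_; _≤_; _<_; _<ᵇ_; z≤n; s≤s)
import Data.Nat.Properties as ℕ
open import Data.Product.Base using (∃; ∃-syntax; _×_; _,_; proj₁; proj₂)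
open import Data.Sum.Base using (_⊎_; inj₁; inj₂)
open import Data.Vec.Base using (tabulate)
open import Level using (0ℓ)
open import Relation.Binary.Construct.Closure.ReflexiveTransitive
  using (Star; ε; _◅_)
open import Relation.Binary.Core using (Rel)
open import Relation.Binary.Definitions
  using (Symmetric; Irreflexive; Decidable)
open import Relation.Binary.PropositionalEquality
  using (_≡_; _≢_; refl; sym; subst)
open import Relation.Nullary.Decidable
  using (Dec; yes; no; does; ¬?; map′; _×-dec_; _⊎-dec_; _→-dec_)
open import Relation.Nullary.Negation using (¬_; contradiction)

record Graph (n : ℕ) : Set₁ where
  field
    Adj        : Rel (Fin n) 0ℓ
    adj-sym    : Symmetric Adj
    adj-irrefl : Irreflexive _≡_ Adj
    adj?       : Decidable Adj

open Graph using (Adj; adj-sym; adj?)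

Connected : ∀ {n} → Graph n → Set
Connected G = ∀ u v → Star (Adj G) u v

neighbours : ∀ {n} → Graph n → Fin n → Subset n
neighbours G v = tabulate λ u → does (adj? G v u)

complete : ∀ n → Graph n
complete n = record
  { Adj        = _≢_
  ; adj-sym    = λ i≢j j≡i → i≢j (sym j≡i)
  ; adj-irrefl = λ i≡j i≢j → i≢j i≡j
  ; adj?       = λ i j → ¬? (i Fin.≟ j)
  }

-- The first a vertices form one side, the remaining b the other.
completeBipartite : ∀ a b → Graph (a + b)
completeBipartite a b = record
  { Adj        = λ i j → side i ≢ side j
  ; adj-sym    = λ i≢j j≡i → i≢j (sym j≡i)
  ; adj-irrefl = λ { refl i≢i → i≢i refl }
  ; adj?       = λ i j → ¬? (side i Bool.≟ side j)
  }
  where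
  side : Fin (a + b) → Bool
  side i = toℕ i <ᵇ a

-- Connectedness of the subgraph of G induced by B.
InducesConnected : ∀ {n} → Graph n → Subset n → Set
InducesConnected G B =
  ∀ u v → u ∈ B → v ∈ B → Star (λ x y → x ∈ B × y ∈ B × Adj G x y) u v

-- H is a minor of G: contracting each branch set to a single vertex, and
-- deleting what is left over, turns G into H.
record _IsMinorOf_ {m n} (H : Graph m) (G : Graph n) : Set where
  field
    branch    : Fin m → Subset n
    nonempty  : ∀ i → Nonempty (branch i)
    connected : ∀ i → InducesConnected G (branch i)
    disjoint  : ∀ i j → i ≢ j → Empty (branch i ∩ branch j)
    edge      : ∀ i j → Adj H i j →
                ∃[ u ] ∃[ v ] (u ∈ branch i × v ∈ branch j × Adj G u v)

-- Outerplanarity in its combinatorial form: the forbidden-minor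
-- description stands in for embeddings in the plane.
Outerplanar : ∀ {n} → Graph n → Set
Outerplanar G =
  ¬ (complete 4 IsMinorOf G) × ¬ (completeBipartite 2 3 IsMinorOf G)

-- A position of the marking game is the set S of marked vertices.
-- S is empty only before Alice's first move.
Legal : ∀ {n} → Graph n → Subset n → Fin n → Set
Legal G S v = v ∉ S × (Empty S ⊎ ∃[ u ] (u ∈ S × Adj G v u))

-- Every unmarked vertex has at most k - 1 marked neighbours.
Safe : ∀ {n} → Graph n → ℕ → Subset n → Set
Safe G k S = ∀ v → v ∉ S → ∣ S ∩ neighbours G v ∣ < k

data Player : Set where
  alice bob : Player

-- Strategy G k p S is the type of Alice's strategies, presented as game
-- trees, from the position S with player p to move, that keep all
-- positions (S included) safe for k until every vertex is marked.
data Strategy {n} (G : Graph n) (k : ℕ) : Player → Subset n → Set where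
  finished  : ∀ {p S} → Safe G k S → (∀ v → v ∈ S) → Strategy G k p S
  aliceMove : ∀ {S} → Safe G k S →
              ∀ v → Legal G S v → Strategy G k bob (S ∪ ⁅ v ⁆) →
              Strategy G k alice S
  bobMoves  : ∀ {S} → Safe G k S →
              (∀ v → Legal G S v → Strategy G k alice (S ∪ ⁅ v ⁆)) →
              Strategy G k bob S

AliceWins : ∀ {n} → Graph n → ℕ → Set
AliceWins G k = Strategy G k alice ⊥

IsLeast : (ℕ → Set) → ℕ → Set
IsLeast P k = P k × (∀ j → P j → k ≤ j)

private

  grow : ∀ {n} {S : Subset n} {v} m → v ∉ S → n ≤ suc m + ∣ S ∣ →
         n ≤ m + ∣ S ∪ ⁅ v ⁆ ∣
  grow {S = S} {v} m v∉S n≤ = ℕ.≤-trans n≤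
    (subst (_≤ m + ∣ S ∪ ⁅ v ⁆ ∣) (ℕ.+-suc m ∣ S ∣)
      (ℕ.+-monoʳ-≤ m (p⊂q⇒∣p∣<∣q∣ S⊂)))
    where
    S⊂ : S ⊂ S ∪ ⁅ v ⁆
    S⊂ = p⊆p∪q ⁅ v ⁆ , v , q⊆p∪q S ⁅ v ⁆ (x∈⁅x⁆ v) , v∉S

  full : ∀ {n} {S : Subset n} → n ≤ ∣ S ∣ → ∀ v → v ∈ S
  full {S = S} n≤ v =
    subst (v ∈_) (sym (∣p∣≡n⇒p≡⊤ (ℕ.≤-antisym (∣p∣≤n S) n≤))) ∈⊤

  module _ {n} (G : Graph n) where

    legal? : ∀ S v → Dec (Legal G S v)
    legal? S v = ¬? (v ∈? S) ×-dec
      (¬? (nonempty? S) ⊎-dec Fin.any? λ u → (u ∈? S) ×-dec adj? G v u)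

    safe? : ∀ k S → Dec (Safe G k S)
    safe? k S = Fin.all? λ v →
      ¬? (v ∈? S) →-dec (∣ S ∩ neighbours G v ∣ ℕ.<? k)

    safe : ∀ {k p S} → Strategy G k p S → Safe G k S
    safe (finished s _)      = s
    safe (aliceMove s _ _ _) = s
    safe (bobMoves s _)      = s

    -- In the following, m bounds the number of moves left.
    strategy? : ∀ k m p S → n ≤ m + ∣ S ∣ → Dec (Strategy G k p S)
    strategy? k m p S n≤ with safe? k S
    ... | no ¬s = no λ σ → ¬s (safe σ)
    ... | yes s with Fin.all? (_∈? S)
    ... | yes f = yes (finished s f)
    strategy? k zero    p     S n≤ | yes s | no ¬f = contradiction (full n≤) ¬f
    strategy? k (suc m) alice S n≤ | yes s | no ¬f =
      map′ (λ { (v , l , σ) → aliceMove s v l σ })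
           (λ { (finished _ f) → contradiction f ¬f
              ; (aliceMove _ v l σ) → v , l , σ })
           (Fin.any? move?)
      where
      move? : ∀ v → Dec (Legal G S v × Strategy G k bob (S ∪ ⁅ v ⁆))
      move? v with legal? S v
      ... | no ¬l = no λ lσ → ¬l (proj₁ lσ)
      ... | yes l = map′ (l ,_) proj₂
                      (strategy? k m bob _ (grow m (proj₁ l) n≤))
    strategy? k (suc m) bob   S n≤ | yes s | no ¬f =
      map′ (bobMoves s)
           (λ { (finished _ f) → contradiction f ¬f
              ; (bobMoves _ σ) → σ })
           (Fin.all? reply?)
      where
      reply? : ∀ v → Dec (Legal G S v → Strategy G k alice (S ∪ ⁅ v ⁆))
      reply? v with legal? S v
      ... | no ¬l = yes λ l → contradiction l ¬l
      ... | yes l = map′ (λ σ _ → σ) (λ σ → σ l)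
                      (strategy? k m alice _ (grow m (proj₁ l) n≤))

    crossing : ∀ {S u v} → Star (Adj G) u v → u ∈ S → v ∉ S →
               ∃[ w ] (w ∉ S × ∃[ x ] (x ∈ S × Adj G w x))
    crossing ε u∈S v∉S = contradiction u∈S v∉S
    crossing {S} (_◅_ {j = w} a as) u∈S v∉S with w ∈? S
    ... | yes w∈S = crossing as w∈S v∉S
    ... | no  w∉S = w , w∉S , _ , u∈S , adj-sym G a

    legalMove : Connected G → ∀ S → ¬ (∀ v → v ∈ S) → ∃ (Legal G S)
    legalMove c S ¬f with Fin.¬∀⟶∃¬ n (_∈ S) (_∈? S) ¬f
    ... | v , v∉S with nonempty? S
    ... | no  empty     = v , v∉S , inj₁ empty
    ... | yes (u , u∈S) with crossing (c u v) u∈S v∉S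
    ... | w , w∉S , e   = w , w∉S , inj₂ e

    trivialStrategy : Connected G → ∀ m p S → n ≤ m + ∣ S ∣ →
                      Strategy G (suc n) p S
    trivialStrategy c m p S n≤ with Fin.all? (_∈? S)
    ... | yes f = finished (λ v _ → s≤s (∣p∣≤n (S ∩ neighbours G v))) f
    trivialStrategy c zero p S n≤ | no ¬f = contradiction (full n≤) ¬f
    trivialStrategy c (suc m) alice S n≤ | no ¬f with legalMove c S ¬f
    ... | v , l = aliceMove (λ v _ → s≤s (∣p∣≤n (S ∩ neighbours G v))) v l
                    (trivialStrategy c m bob _ (grow m (proj₁ l) n≤))
    trivialStrategy c (suc m) bob S n≤ | no ¬f =
      bobMoves (λ v _ → s≤s (∣p∣≤n (S ∩ neighbours G v))) λ v l →
        trivialStrategy c m alice _ (grow m (proj₁ l) n≤)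

  least : ∀ (P : ℕ → Set) → (∀ k → Dec (P k)) → ∀ k → P k → ∃ (IsLeast P)
  least P P? zero    p = zero , p , λ _ _ → z≤n
  least P P? (suc k) p with P? 0
  ... | yes p₀ = zero , p₀ , λ _ _ → z≤n
  ... | no ¬p₀ with least (λ j → P (suc j)) (λ j → P? (suc j)) k p
  ... | i , pᵢ , min = suc i , pᵢ , λ
    { zero    p₀ → ⊥-elim (¬p₀ p₀)
    ; (suc j) pⱼ → s≤s (min j pⱼ) }

leastWinning : ∀ {n} (G : Graph n) → Connected G → ∃ (IsLeast (AliceWins G))
leastWinning {n} G c = least (AliceWins G)
  (λ k → strategy? G k n alice ⊥ (ℕ.m≤m+n n _))
  (suc n) (trivialStrategy G c n alice ⊥ (ℕ.m≤m+n n _))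

-- The connected game coloring number.
col-cg : ∀ {n} (G : Graph n) → Connected G → ℕ
col-cg G c = proj₁ (leastWinning G c)

col-cg-least : ∀ {n} (G : Graph n) (c : Connected G) →
               IsLeast (AliceWins G) (col-cg G c)
col-cg-least G c = proj₂ (leastWinning G c)

{-# OPTIONS --safe #-}
-- Alice keeps every component C of the unmarked part adjacent to at most three
-- marked vertices.  When Bob marks b in C, the components of C - b are adjacent
-- only to b and the three old neighbours x, y, z of C, and by K₂,₃-freeness at
-- most one of them, D, is adjacent to all four; say b is adjacent to x.  Alice
-- answers in D with the neighbour c of x that is nearest to the neighbours of
-- y.  No component of D - c is then adjacent to both x and y (K₄, K₂,₃), nor to
-- b and one of y, z (K₂,₃), so each is adjacent to c and at most two others.
-- Without such a D she plays in the same way in any component.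
module Submission where

open import Defs
open import Data.Fin.Base using (Fin; zero; suc)
open import Data.Fin.Properties using (_≟_; any?; all?; ¬∀⟶∃¬)
open import Data.Fin.Subset
open import Data.Fin.Subset.Induction using (Acc; acc; ⊃-wellFounded)
open import Data.Fin.Subset.Properties
open import Data.List.Base using (List; []; _∷_; length; foldr)
open import Data.List.Membership.Propositional using () renaming (_∈_ to _∈ˡ_)
open import Data.List.Relation.Unary.Any using (here; there)
open import Data.Nat.Base using (ℕ; zero; suc; NonZero; _≤_; z≤n; s≤s)
import Data.Nat.Properties as ℕ
open import Data.Product.Base using (∃-syntax; _×_; _,_; proj₁; proj₂)
open import Data.Sum.Base using (_⊎_; inj₁; inj₂; [_,_])
open import Data.Vec.Base using (Vec; []; _∷_; lookup)
open import Data.Vec.Properties using ([]=⇒lookup; lookup∘tabulate)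
open import Data.Vec.Relation.Unary.All using (All; []; _∷_)
open import Data.Vec.Relation.Unary.All.Properties using (lookup⁺)
open import Data.Vec.Relation.Unary.AllPairs using (AllPairs; []; _∷_)
open import Function.Base using (_∘_; id)
open import Level using (0ℓ)
open import Relation.Binary.Construct.Closure.ReflexiveTransitive
  using (Star; ε; _◅_; _◅◅_) renaming (map to map-star)
open import Relation.Binary.Core using (Rel)
open import Relation.Binary.Definitions using (Symmetric)
open import Relation.Binary.PropositionalEquality
  using (_≡_; _≢_; refl; sym; trans; subst; ≢-sym)
open import Relation.Nullary.Decidable
  using (Dec; yes; no; does; ¬?; map′; _×-dec_; decidable-stable)
open import Relation.Nullary.Negation using (¬_; contradiction)
open import Relation.Unary using (Decidable)

open Graph using (Adj; adj-sym; adj?)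

-- Pairwise relations, walks and finite sets of vertices

allPairs-lookup : ∀ {A : Set} {R : Rel A 0ℓ} {k} {xs : Vec A k} →
                  Symmetric R → AllPairs R xs →
                  ∀ i j → i ≢ j → R (lookup xs i) (lookup xs j)
allPairs-lookup s _        zero    zero    i≢j = contradiction refl i≢j
allPairs-lookup s (r ∷ rs) zero    (suc j) i≢j = lookup⁺ r j
allPairs-lookup s (r ∷ rs) (suc i) zero    i≢j = s (lookup⁺ r i)
allPairs-lookup s (r ∷ rs) (suc i) (suc j) i≢j =
  allPairs-lookup s rs i j λ { refl → i≢j refl }

-- `R` is arbitrary so that a walk confined to a set also reports that the ends of the crossing edge
-- lie in that set.
leave : ∀ {n} {R : Rel (Fin n) 0ℓ} {M : Subset n} {x z} →
        Star R x z → x ∈ M → z ∉ M → ∃[ m ] ∃[ d ] (m ∈ M × d ∉ M × R m d)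
leave ε x∈M z∉M = contradiction x∈M z∉M
leave {M = M} (_◅_ {j = w} r rs) x∈M z∉M with w ∈? M
... | yes w∈M = leave rs w∈M z∉M
... | no  w∉M = _ , _ , x∈M , w∉M , r

module _ {n : ℕ} where

  infixl 6 _▹_
  _▹_ : Subset n → Fin n → Subset n
  S ▹ v = S ∪ ⁅ v ⁆

  old : ∀ {S u v} → u ∈ S → u ∈ S ▹ v
  old = p⊆p∪q _

  new : ∀ {S v} → v ∈ S ▹ v
  new {S} {v} = q⊆p∪q S ⁅ v ⁆ (x∈⁅x⁆ v)

  old⊎new : ∀ {S u v} → u ∈ S ▹ v → u ∈ S ⊎ u ≡ v
  old⊎new {S} {v = v} u∈ with x∈p∪q⁻ S ⁅ v ⁆ u∈
  ... | inj₁ u∈S = inj₁ u∈S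
  ... | inj₂ u∈v = inj₂ (x∈⁅y⁆⇒x≡y v u∈v)

  ∉-▹ : ∀ {S u v} → u ∉ S → u ≢ v → u ∉ S ▹ v
  ∉-▹ u∉S u≢v u∈ with old⊎new u∈
  ... | inj₁ u∈S = u∉S u∈S
  ... | inj₂ u≡v = u≢v u≡v

  ▹-⊃ : ∀ {S v} → v ∉ S → (S ▹ v) ⊃ S
  ▹-⊃ {S} {v} v∉S = old , v , new {S} , v∉S

  Disjoint : Subset n → Subset n → Set
  Disjoint A B = ∀ {v} → v ∈ A → v ∉ B

  disjoint-sym : Symmetric Disjoint
  disjoint-sym d v∈B v∈A = d v∈A v∈B

  ⁅⁆-disjoint : ∀ {v A} → v ∉ A → Disjoint ⁅ v ⁆ A
  ⁅⁆-disjoint {v} v∉A u∈ u∈A with refl ← x∈⁅y⁆⇒x≡y v u∈ = v∉A u∈A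

  ≢⇒disjoint : ∀ {p q : Fin n} → p ≢ q → Disjoint ⁅ p ⁆ ⁅ q ⁆
  ≢⇒disjoint p≢q = ⁅⁆-disjoint (x≢y⇒x∉⁅y⁆ p≢q)

  ▹-disjoint : ∀ {A B v} → Disjoint A B → v ∉ B → Disjoint (A ▹ v) B
  ▹-disjoint d v∉B u∈ u∈B with old⊎new u∈
  ... | inj₁ u∈A  = d u∈A u∈B
  ... | inj₂ refl = v∉B u∈B

∣p∪⁅x⁆∣≤1+∣p∣ : ∀ {n} (p : Subset n) x → ∣ p ∪ ⁅ x ⁆ ∣ ≤ suc ∣ p ∣
∣p∪⁅x⁆∣≤1+∣p∣ (inside  ∷ p) zero rewrite ∪-identityʳ p = ℕ.n≤1+n _
∣p∪⁅x⁆∣≤1+∣p∣ (outside ∷ p) zero rewrite ∪-identityʳ p = ℕ.≤-refl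
∣p∪⁅x⁆∣≤1+∣p∣ (inside  ∷ p) (suc x) = s≤s (∣p∪⁅x⁆∣≤1+∣p∣ p x)
∣p∪⁅x⁆∣≤1+∣p∣ (outside ∷ p) (suc x) = ∣p∪⁅x⁆∣≤1+∣p∣ p x

fromList : ∀ {n} → List (Fin n) → Subset n
fromList = foldr (λ x p → p ▹ x) ⊥

∈-fromList : ∀ {n} {x : Fin n} {xs} → x ∈ˡ xs → x ∈ fromList xs
∈-fromList {xs = x ∷ xs} (here refl) = new {S = fromList xs}
∈-fromList               (there x∈)  = old (∈-fromList x∈)

∣fromList∣≤length : ∀ {n} (xs : List (Fin n)) → ∣ fromList xs ∣ ≤ length xs
∣fromList∣≤length {n} []   = ℕ.≤-reflexive (∣⊥∣≡0 n)
∣fromList∣≤length (x ∷ xs) =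
  ℕ.≤-trans (∣p∪⁅x⁆∣≤1+∣p∣ (fromList xs) x) (s≤s (∣fromList∣≤length xs))

-- Neighbourhoods and connected components

module _ {n : ℕ} (G : Graph n) where

  ∈neighbours⇒Adj : ∀ {u v} → u ∈ neighbours G v → Adj G v u
  -- Abstracting the decision together with the equation makes `does` compute in the latter, which
  -- is absurd in the `no` case.
  ∈neighbours⇒Adj {u} {v} u∈ with adj? G v u
    | trans (sym (lookup∘tabulate (does ∘ adj? G v) u)) ([]=⇒lookup u∈)
  ... | yes a | _ = a
  ... | no  _ | ()

  connected-⁅⁆ : ∀ v → InducesConnected G ⁅ v ⁆
  connected-⁅⁆ v x y x∈ y∈
    with refl ← x∈⁅y⁆⇒x≡y v x∈ | refl ← x∈⁅y⁆⇒x≡y v y∈ = ε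

  connected-▹ : ∀ {S s v} → InducesConnected G S → s ∈ S → Adj G v s →
                InducesConnected G (S ▹ v)
  connected-▹ {S} {s} {v} conn s∈S a x y x∈ y∈ = go (old⊎new x∈) (old⊎new y∈)
    where
    widen : ∀ {x y} → x ∈ S → y ∈ S →
            Star (λ x y → x ∈ S ▹ v × y ∈ S ▹ v × Adj G x y) x y
    widen x∈S y∈S =
      map-star (λ { (p , q , r) → old p , old q , r }) (conn _ _ x∈S y∈S)
    go : x ∈ S ⊎ x ≡ v → y ∈ S ⊎ y ≡ v → _
    go (inj₁ x∈S)  (inj₁ y∈S)  = widen x∈S y∈S
    go (inj₁ x∈S)  (inj₂ refl) =
      widen x∈S s∈S ◅◅ (old s∈S , new {S = S} , adj-sym G a) ◅ ε
    go (inj₂ refl) (inj₁ y∈S)  = (new {S = S} , old s∈S , a) ◅ widen s∈S y∈S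
    go (inj₂ refl) (inj₂ refl) = ε

  -- A connected component of the subgraph induced by `P`. Besides the unmarked vertices, `P` will
  -- be a connected set without one vertex, or without the neighbours of one vertex.
  record Component (P : Fin n → Set) (C : Subset n) : Set where
    field
      nonempty  : Nonempty C
      connected : InducesConnected G C
      satisfies : ∀ {v} → v ∈ C → P v
      closed    : ∀ {v w} → v ∈ C → P w → Adj G v w → w ∈ C

  open Component

  -- Grow the singleton of `u` by adjacent `P`-vertices until none is left; strict growth of subsets
  -- is well-founded.
  component : ∀ {P u} → Decidable P → P u → ∃[ C ] (u ∈ C × Component P C)
  component {P} {u} P? Pu =
    saturate (⊃-wellFounded _) (x∈⁅x⁆ u) (connected-⁅⁆ u)
      λ v∈ → subst P (sym (x∈⁅y⁆⇒x≡y u v∈)) Pu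
    where
    saturate : ∀ {C} → Acc _⊃_ C → u ∈ C → InducesConnected G C →
               (∀ {v} → v ∈ C → P v) → ∃[ C ] (u ∈ C × Component P C)
    saturate {C} (acc rec) u∈C conn C⊆P
      with any? (λ w → ¬? (w ∈? C) ×-dec P? w ×-dec
                      any? λ v → (v ∈? C) ×-dec adj? G w v)
    ... | yes (w , w∉C , Pw , v , v∈C , a) =
      saturate (rec (▹-⊃ w∉C)) (old u∈C) (connected-▹ conn v∈C a) λ x∈ →
        [ C⊆P , (λ { refl → Pw }) ] (old⊎new x∈)
    ... | no ¬w = C , u∈C , record
      { nonempty  = u , u∈C
      ; connected = conn
      ; satisfies = C⊆P
      ; closed    = λ {v} {w} v∈C Pw a → decidable-stable (w ∈? C) λ w∉C →
                      ¬w (w , w∉C , Pw , v , v∈C , adj-sym G a)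
      }

  -- A walk inside `A` that left `C` would do so along an edge to a `P`-vertex, against closedness.
  absorb : ∀ {P C A x} → Component P C → InducesConnected G A →
           (∀ {v} → v ∈ A → P v) → x ∈ A → x ∈ C → A ⊆ C
  absorb {C = C} comp conn A⊆P x∈A x∈C {z} z∈A with z ∈? C
  ... | yes z∈C = z∈C
  ... | no  z∉C with leave (conn _ _ x∈A z∈A) x∈C z∉C
  ... | m , d , m∈C , d∉C , _ , d∈A , a =
    contradiction (closed comp m∈C (A⊆P d∈A) a) d∉C

  -- Adjacent branch sets and minors

  Sees : Subset n → Fin n → Set
  Sees A q = ∃[ w ] (w ∈ A × Adj G w q)

  sees? : ∀ A q → Dec (Sees A q)
  sees? A q = any? λ w → (w ∈? A) ×-dec adj? G w q

  sees-⊆ : ∀ {A B q} → A ⊆ B → Sees A q → Sees B q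
  sees-⊆ A⊆B (w , w∈A , a) = w , A⊆B w∈A , a

  Touch : Subset n → Subset n → Set
  Touch A B = ∃[ u ] ∃[ v ] (u ∈ A × v ∈ B × Adj G u v)

  touch-sym : Symmetric Touch
  touch-sym (u , v , u∈A , v∈B , a) = v , u , v∈B , u∈A , adj-sym G a

  touch-∋ : ∀ {A B q} → Sees A q → q ∈ B → Touch A B
  touch-∋ (w , w∈A , a) q∈B = w , _ , w∈A , q∈B , a

  touch-⁅⁆ : ∀ {A q} → Sees A q → Touch ⁅ q ⁆ A
  touch-⁅⁆ {q = q} s = touch-sym (touch-∋ s (x∈⁅x⁆ q))

  Branch : Subset n → Set
  Branch A = Nonempty A × InducesConnected G A

  branch-⁅⁆ : ∀ v → Branch ⁅ v ⁆
  branch-⁅⁆ v = (v , x∈⁅x⁆ v) , connected-⁅⁆ v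

  disjoint⇒empty : ∀ {A B : Subset n} → Disjoint A B → Empty (A ∩ B)
  disjoint⇒empty {A} {B} d (v , v∈) = d (proj₁ v∈×) (proj₂ v∈×)
    where v∈× = x∈p∩q⁻ A B v∈

  K₄-minor : {As : Vec (Subset n) 4} → All Branch As →
             AllPairs Disjoint As → AllPairs Touch As → complete 4 IsMinorOf G
  K₄-minor {As} bs ds ts = record
    { branch    = lookup As
    ; nonempty  = λ i → proj₁ (lookup⁺ bs i)
    ; connected = λ i → proj₂ (lookup⁺ bs i)
    ; disjoint  = λ i j i≢j →
        disjoint⇒empty (allPairs-lookup disjoint-sym ds i j i≢j)
    ; edge      = allPairs-lookup touch-sym ts
    }

  K₂₃-minor : ∀ {A B} {Cs : Vec (Subset n) 3} → All Branch (A ∷ B ∷ Cs) →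
              AllPairs Disjoint (A ∷ B ∷ Cs) →
              All (Touch A) Cs → All (Touch B) Cs →
              completeBipartite 2 3 IsMinorOf G
  K₂₃-minor {A} {B} {Cs} bs ds as bs′ = record
    { branch    = lookup (A ∷ B ∷ Cs)
    ; nonempty  = λ i → proj₁ (lookup⁺ bs i)
    ; connected = λ i → proj₂ (lookup⁺ bs i)
    ; disjoint  = λ i j i≢j →
        disjoint⇒empty (allPairs-lookup disjoint-sym ds i j i≢j)
    ; edge      = edge
    }
    where
    edge : ∀ i j → Adj (completeBipartite 2 3) i j →
           Touch (lookup (A ∷ B ∷ Cs) i) (lookup (A ∷ B ∷ Cs) j)
    edge zero          (suc (suc j)) _ = lookup⁺ as j
    edge (suc zero)    (suc (suc j)) _ = lookup⁺ bs′ j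
    edge (suc (suc i)) zero          _ = touch-sym (lookup⁺ as i)
    edge (suc (suc i)) (suc zero)    _ = touch-sym (lookup⁺ bs′ i)
    -- In the remaining cases both ends lie on the same side, and the two values of `side` compute
    -- to the same Boolean.
    edge zero          zero          ≢ = contradiction refl ≢
    edge zero          (suc zero)    ≢ = contradiction refl ≢
    edge (suc zero)    zero          ≢ = contradiction refl ≢
    edge (suc zero)    (suc zero)    ≢ = contradiction refl ≢
    edge (suc (suc i)) (suc (suc j)) ≢ = contradiction refl ≢

  -- Components after removing or marking a vertex

  -- `X` is the component of `r` in `T` - `q`; a walk in `T` from `r` to `q` can leave it only at
  -- `q`. Applied to the marked set, this gives two adjacent branch sets.
  approach : ∀ {T q r} → InducesConnected G T → q ∈ T → r ∈ T → q ≢ r →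
             ∃[ X ] (r ∈ X × Branch X × X ⊆ T × q ∉ X × Sees X q)
  approach {T} {q} {r} conn q∈T r∈T q≢r
    with component (λ v → (v ∈? T) ×-dec ¬? (v ≟ q)) (r∈T , ≢-sym q≢r)
  ... | X , r∈X , X-comp
    with leave (conn r q r∈T q∈T) r∈X (λ q∈X → proj₂ (satisfies X-comp q∈X) refl)
  ... | m , d , m∈X , d∉X , _ , d∈T , a =
    X , r∈X , (nonempty X-comp , connected X-comp) ,
    proj₁ ∘ satisfies X-comp , (λ q∈X → proj₂ (satisfies X-comp q∈X) refl) ,
    m , m∈X , subst (Adj G m) d≡q a
    where
    d≡q : d ≡ q
    d≡q = decidable-stable (d ≟ q) λ d≢q →
      d∉X (closed X-comp m∈X (d∈T , d≢q) a)

  -- If `B` sees `c`, it meets `C` next to `c` and is absorbed. Otherwise it is still closed when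
  -- `c` counts as unmarked, the only vertex whose status changed.
  split : ∀ {S C B c} → Component (_∉ S) C → c ∈ C → Component (_∉ S ▹ c) B →
          (Sees B c × B ⊆ C) ⊎ (¬ Sees B c × Component (_∉ S) B)
  split {S} {C} {B} {c} C-comp c∈C B-comp with sees? B c
  ... | yes (w , w∈B , a) = inj₁ ((w , w∈B , a) ,
    absorb C-comp (connected B-comp) (λ v∈B → satisfies B-comp v∈B ∘ old) w∈B
      (closed C-comp c∈C (satisfies B-comp w∈B ∘ old) (adj-sym G a)))
  ... | no ¬s = inj₂ (¬s , record
    { nonempty  = nonempty B-comp
    ; connected = connected B-comp
    ; satisfies = λ v∈B → satisfies B-comp v∈B ∘ old
    ; closed    = λ {v} {w} v∈B w∉S a → closed B-comp v∈B
        (∉-▹ w∉S λ { refl → ¬s (v , v∈B , a) }) a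
    })

  -- Configurations excluded by the forbidden minors

  module _ (¬K₄ : ¬ complete 4 IsMinorOf G)
           (¬K₂₃ : ¬ completeBipartite 2 3 IsMinorOf G) where

    -- A K₂,₃ with `D`, `E` on one side and `x`, `y`, `z` on the other.
    ¬three-common : ∀ {S D E x y z} →
      Component (_∉ S) D → Component (_∉ S) E → Disjoint D E →
      x ∈ S → y ∈ S → z ∈ S → x ≢ y → x ≢ z → y ≢ z →
      Sees D x → Sees D y → Sees D z → Sees E x → Sees E y → ¬ Sees E z
    ¬three-common {S} {D} {E} {x} {y} {z} D-comp E-comp D∩E x∈S y∈S z∈S
                  x≢y x≢z y≢z Dx Dy Dz Ex Ey Ez =
      ¬K₂₃ (K₂₃-minor
        ((nonempty D-comp , connected D-comp) ∷
         (nonempty E-comp , connected E-comp) ∷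
         branch-⁅⁆ x ∷ branch-⁅⁆ y ∷ branch-⁅⁆ z ∷ [])
        ((D∩E ∷ avoid D-comp x∈S ∷ avoid D-comp y∈S ∷ avoid D-comp z∈S ∷ []) ∷
         (avoid E-comp x∈S ∷ avoid E-comp y∈S ∷ avoid E-comp z∈S ∷ []) ∷
         (≢⇒disjoint x≢y ∷ ≢⇒disjoint x≢z ∷ []) ∷ (≢⇒disjoint y≢z ∷ []) ∷ [] ∷ [])
        (touch Dx ∷ touch Dy ∷ touch Dz ∷ [])
        (touch Ex ∷ touch Ey ∷ touch Ez ∷ []))
      where
      avoid : ∀ {C q} → Component (_∉ S) C → q ∈ S → Disjoint C ⁅ q ⁆
      avoid C-comp q∈S =
        disjoint-sym (⁅⁆-disjoint λ q∈C → satisfies C-comp q∈C q∈S)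
      touch : ∀ {C q} → Sees C q → Touch C ⁅ q ⁆
      touch s = touch-∋ s (x∈⁅x⁆ _)

    -- Otherwise `q` and `B` against `b`, `c` and the part `X` of `S` - `q` containing `r` form a
    -- K₂,₃: `q` touches `X` because `S` is connected, and `B` touches it at `r`.
    ¬beyond-twins : ∀ {S b c q r B} → InducesConnected G S →
      q ∈ S → r ∈ S → q ≢ r → b ∉ S → c ∉ S ▹ b → Adj G b q → Adj G c q →
      Component (_∉ S ▹ b ▹ c) B → Sees B b → Sees B c → ¬ Sees B r
    ¬beyond-twins {S} {b} {c} {q} {r} {B} conn q∈S r∈S q≢r b∉S c∉ b~q c~q
                  B-comp Bb Bc Br
      with approach conn q∈S r∈S q≢r
    ... | X , r∈X , X-branch , X⊆S , q∉X , Xq =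
      ¬K₂₃ (K₂₃-minor
        (branch-⁅⁆ q ∷ (nonempty B-comp , connected B-comp) ∷
         branch-⁅⁆ b ∷ branch-⁅⁆ c ∷ X-branch ∷ [])
        ((⁅⁆-disjoint (λ q∈B → satisfies B-comp q∈B (old (old q∈S))) ∷
          ≢⇒disjoint (λ { refl → b∉S q∈S }) ∷ ≢⇒disjoint (λ { refl → c∉ (old q∈S) }) ∷
          ⁅⁆-disjoint q∉X ∷ []) ∷
         (disjoint-sym
            (⁅⁆-disjoint λ b∈B → satisfies B-comp b∈B (old (new {S = S}))) ∷
          disjoint-sym
            (⁅⁆-disjoint λ c∈B → satisfies B-comp c∈B (new {S = S ▹ b})) ∷
          (λ v∈B v∈X → satisfies B-comp v∈B (old (old (X⊆S v∈X)))) ∷ []) ∷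
         (≢⇒disjoint (λ { refl → c∉ (new {S = S}) }) ∷
          ⁅⁆-disjoint (b∉S ∘ X⊆S) ∷ []) ∷
         (⁅⁆-disjoint (c∉ ∘ old ∘ X⊆S) ∷ []) ∷ [] ∷ [])
        (touch-⁅⁆ (b , x∈⁅x⁆ b , b~q) ∷ touch-⁅⁆ (c , x∈⁅x⁆ c , c~q) ∷
         touch-⁅⁆ Xq ∷ [])
        (touch-∋ Bb (x∈⁅x⁆ b) ∷ touch-∋ Bc (x∈⁅x⁆ c) ∷ touch-∋ Br r∈X ∷ []))

    -- A K₄ on `q`, `X`, `L`, `B`: `L` and `B` both touch `X` at `r`, and they touch each other at
    -- `c`. The chain `L` joins `c` to `r`; it will be a single common neighbour of `q` and `r`, or
    -- the set `M` of `separator` with `c` added.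
    ¬beside-chain : ∀ {S X L B q r c} →
      Branch X → X ⊆ S → q ∉ X → Sees X q → r ∈ X → q ∈ S →
      InducesConnected G L → Disjoint L S → Disjoint L B →
      c ∈ L → Adj G c q → Sees L r →
      Component (_∉ S ▹ c) B → Sees B c → Sees B q → ¬ Sees B r
    ¬beside-chain {S} {X} {L} {B} {q} {c = c} X-branch X⊆S q∉X Xq r∈X q∈S
                  L-conn L∩S L∩B c∈L c~q Lr B-comp Bc Bq Br =
      ¬K₄ (K₄-minor
        (branch-⁅⁆ q ∷ X-branch ∷ ((c , c∈L) , L-conn) ∷
         (nonempty B-comp , connected B-comp) ∷ [])
        ((⁅⁆-disjoint q∉X ∷ ⁅⁆-disjoint (λ q∈L → L∩S q∈L q∈S) ∷
          ⁅⁆-disjoint (λ q∈B → satisfies B-comp q∈B (old q∈S)) ∷ []) ∷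
         ((λ v∈X v∈L → L∩S v∈L (X⊆S v∈X)) ∷
          (λ v∈X v∈B → satisfies B-comp v∈B (old (X⊆S v∈X))) ∷ []) ∷
         (L∩B ∷ []) ∷ [] ∷ [])
        ((touch-⁅⁆ Xq ∷ touch-⁅⁆ (c , c∈L , c~q) ∷ touch-⁅⁆ Bq ∷ []) ∷
         (touch-sym (touch-∋ Lr r∈X) ∷ touch-sym (touch-∋ Br r∈X) ∷ []) ∷
         (touch-sym (touch-∋ Bc c∈L) ∷ []) ∷ [] ∷ []))

    -- Unless c can be chosen adjacent to r, it is adjacent to a connected set M
    -- of non-neighbours of q that reaches r.  If B avoids M, then q, the part X
    -- of S - q containing r, M + c and B form a K₄.  Otherwise B joins M to a
    -- second neighbour c′ of q, and q, M against c, c′, X form a K₂,₃.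
    separator : ∀ {S D q r} → InducesConnected G S → Component (_∉ S) D →
      q ∈ S → r ∈ S → q ≢ r → Sees D q → Sees D r →
      ∃[ c ] (c ∈ D × Adj G c q ×
              (∀ {B} → Component (_∉ S ▹ c) B → Sees B c → B ⊆ D →
               Sees B q → ¬ Sees B r))
    separator {S} {D} {q} {r} conn D-comp q∈S r∈S q≢r (z , z∈D , z~q)
              (y , y∈D , y~r)
      with approach conn q∈S r∈S q≢r
    ... | X , r∈X , X-branch , X⊆S , q∉X , Xq with adj? G y q
    ... | yes y~q = y , y∈D , y~q , λ B-comp By _ →
      ¬beside-chain X-branch X⊆S q∉X Xq r∈X q∈S (connected-⁅⁆ y)
        (⁅⁆-disjoint (satisfies D-comp y∈D))
        (⁅⁆-disjoint λ y∈B → satisfies B-comp y∈B (new {S = S}))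
        (x∈⁅x⁆ y) y~q (y , x∈⁅x⁆ y , y~r) B-comp By
    ... | no ¬y~q
      with component (λ v → (v ∈? D) ×-dec ¬? (adj? G v q)) (y∈D , ¬y~q)
    ... | M , y∈M , M-comp
      with leave (connected D-comp y z y∈D z∈D) y∈M
             (λ z∈M → proj₂ (satisfies M-comp z∈M) z~q)
    ... | m , c , m∈M , c∉M , _ , c∈D , m~c =
      c , c∈D , c~q , avoid
      where
      exit : ∀ {m c} → c ∈ D → m ∈ M → c ∉ M → Adj G m c → Adj G c q
      exit {c = c} c∈D m∈M c∉M m~c = decidable-stable (adj? G c q) λ ¬c~q →
        c∉M (closed M-comp m∈M (c∈D , ¬c~q) m~c)

      c~q = exit c∈D m∈M c∉M m~c

      M∩S : Disjoint M S
      M∩S v∈M = satisfies D-comp (proj₁ (satisfies M-comp v∈M))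

      avoid : ∀ {B} → Component (_∉ S ▹ c) B → Sees B c → B ⊆ D →
              Sees B q → ¬ Sees B r
      avoid {B} B-comp Bc B⊆D (z , z∈B , z~q) Br
        with any? (λ v → (v ∈? M) ×-dec (v ∈? B))
      ... | no M∩B=∅ =
        ¬beside-chain X-branch X⊆S q∉X Xq r∈X q∈S
          (connected-▹ (connected M-comp) m∈M (adj-sym G m~c))
          (▹-disjoint M∩S (satisfies D-comp c∈D))
          (▹-disjoint (λ v∈M v∈B → M∩B=∅ (_ , v∈M , v∈B))
            λ c∈B → satisfies B-comp c∈B (new {S = S}))
          (new {S = M}) c~q (y , old y∈M , y~r)
          B-comp Bc (z , z∈B , z~q) Br
      ... | yes (v , v∈M , v∈B)
        with leave (connected B-comp v z v∈B z∈B) v∈M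
               (λ z∈M → proj₂ (satisfies M-comp z∈M) z~q)
      ... | m′ , c′ , m′∈M , c′∉M , _ , c′∈B , m′~c′ =
        ¬K₂₃ (K₂₃-minor
          (branch-⁅⁆ q ∷ (nonempty M-comp , connected M-comp) ∷
           branch-⁅⁆ c ∷ branch-⁅⁆ c′ ∷ X-branch ∷ [])
          ((⁅⁆-disjoint (λ q∈M → M∩S q∈M q∈S) ∷
            ≢⇒disjoint (λ { refl → satisfies D-comp c∈D q∈S }) ∷
            ≢⇒disjoint (λ { refl → satisfies B-comp c′∈B (old q∈S) }) ∷
            ⁅⁆-disjoint q∉X ∷ []) ∷
           (disjoint-sym (⁅⁆-disjoint c∉M) ∷
            disjoint-sym (⁅⁆-disjoint c′∉M) ∷
            (λ v∈M v∈X → M∩S v∈M (X⊆S v∈X)) ∷ []) ∷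
           (≢⇒disjoint (λ { refl → satisfies B-comp c′∈B (new {S = S}) }) ∷
            ⁅⁆-disjoint (satisfies D-comp c∈D ∘ X⊆S) ∷ []) ∷
           (⁅⁆-disjoint (satisfies B-comp c′∈B ∘ old ∘ X⊆S) ∷ []) ∷ [] ∷ [])
          (touch-⁅⁆ (c , x∈⁅x⁆ c , c~q) ∷
           touch-⁅⁆ (c′ , x∈⁅x⁆ c′ , exit (B⊆D c′∈B) m′∈M c′∉M m′~c′) ∷
           touch-⁅⁆ Xq ∷ [])
          (touch-∋ (m , m∈M , m~c) (x∈⁅x⁆ c) ∷
           touch-∋ (m′ , m′∈M , m′~c′) (x∈⁅x⁆ c′) ∷
           touch-∋ (y , y∈M , y~r) r∈X ∷ []))

  -- Bounds on the marked neighbours of components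

  -- Only an upper bound: entries may repeat or be no marked neighbours at all, so short lists can
  -- be padded.
  Within : Subset n → Subset n → List (Fin n) → Set
  Within S C xs = ∀ {q} → q ∈ S → Sees C q → q ∈ˡ xs

  Few : Subset n → Subset n → Set
  Few S C = ∃[ x ] ∃[ y ] ∃[ z ] Within S C (x ∷ y ∷ z ∷ [])

  few⇒four : ∀ {S C} → Few S C → ∃[ xs ] (length xs ≤ 4 × Within S C xs)
  few⇒four (x , y , z , wi) = x ∷ y ∷ z ∷ [] , ℕ.n≤1+n 3 , wi

  -- The invariant that Alice maintains whenever Bob is to move.
  AllFew : Subset n → Set
  AllFew S = ∀ {C} → Component (_∉ S) C → Few S C

  within-▹ : ∀ {S B C c xs} → B ⊆ C → Within S C xs → Within (S ▹ c) B (c ∷ xs)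
  within-▹ B⊆C wi q∈ s with old⊎new q∈
  ... | inj₁ q∈S  = there (wi q∈S (sees-⊆ B⊆C s))
  ... | inj₂ refl = here refl

  few-▹ : ∀ {S B c} → ¬ Sees B c → Few S B → Few (S ▹ c) B
  few-▹ {S} {B} {c} ¬Bc (x , y , z , wi) = x , y , z , wi′
    where
    wi′ : Within (S ▹ c) B (x ∷ y ∷ z ∷ [])
    wi′ q∈ s with old⊎new q∈
    ... | inj₁ q∈S  = wi q∈S s
    ... | inj₂ refl = contradiction s ¬Bc

  -- `p` is excluded only as an old marked neighbour; should it equal `c`, the head of the list
  -- still covers it.
  omit : ∀ {S B c x y z p} → Within (S ▹ c) B (c ∷ x ∷ y ∷ z ∷ []) →
         p ∈ˡ x ∷ y ∷ z ∷ [] → ¬ (p ∈ S × Sees B p) → Few (S ▹ c) B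
  omit {S} {B} {c} {x} {y} {z} {p} wi p∈ ¬p = go p∈
    where
    omitted : ∀ {q} → q ≡ p → q ∈ S ▹ c → Sees B q → q ≡ c
    omitted refl p∈ s with old⊎new p∈
    ... | inj₁ p∈S = contradiction (p∈S , s) ¬p
    ... | inj₂ p≡c = p≡c

    go : p ∈ˡ x ∷ y ∷ z ∷ [] → Few (S ▹ c) B
    go (here refl) = c , y , z , wi′
      where
      wi′ : Within (S ▹ c) B (c ∷ y ∷ z ∷ [])
      wi′ q∈ s with wi q∈ s
      ... | here e          = here e
      ... | there (here e)  = here (omitted e q∈ s)
      ... | there (there m) = there m
    go (there (here refl)) = c , x , z , wi′
      where
      wi′ : Within (S ▹ c) B (c ∷ x ∷ z ∷ [])
      wi′ q∈ s with wi q∈ s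
      ... | here e                  = here e
      ... | there (here e)          = there (here e)
      ... | there (there (here e))  = here (omitted e q∈ s)
      ... | there (there (there m)) = there (there m)
    go (there (there (here refl))) = c , x , y , wi′
      where
      wi′ : Within (S ▹ c) B (c ∷ x ∷ y ∷ [])
      wi′ q∈ s with wi q∈ s
      ... | here e                         = here e
      ... | there (here e)                 = there (here e)
      ... | there (there (here e))         = there (there (here e))
      ... | there (there (there (here e))) = here (omitted e q∈ s)

  -- Both `q` and `r` are among the three entries for `D`, and `B` misses one of them, whose place
  -- `c` can take.
  few-separated : ∀ {S D B c q r} → Few S D → B ⊆ D →
                  q ∈ S → Sees D q → r ∈ S → Sees D r →
                  (Sees B q → ¬ Sees B r) → Few (S ▹ c) B
  few-separated {B = B} {q = q} (_ , _ , _ , wi) B⊆D q∈S Dq r∈S Dr ¬both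
    with sees? B q
  ... | no ¬Bq = omit (within-▹ B⊆D wi) (wi q∈S Dq) (¬Bq ∘ proj₂)
  ... | yes Bq = omit (within-▹ B⊆D wi) (wi r∈S Dr) (¬both Bq ∘ proj₂)

  bring-front : ∀ {q x y z : Fin n} → q ∈ˡ x ∷ y ∷ z ∷ [] →
    ∃[ y′ ] ∃[ z′ ] (∀ {p} → p ∈ˡ x ∷ y ∷ z ∷ [] → p ∈ˡ q ∷ y′ ∷ z′ ∷ [])
  bring-front {y = y} {z} (here refl) = y , z , id
  bring-front {x = x} {z = z} (there (here refl)) = x , z , λ
    { (here e) → there (here e) ; (there (here e)) → here e
    ; (there (there m)) → there (there m) }
  bring-front {x = x} {y} (there (there (here refl))) = x , y , λ
    { (here e) → there (here e) ; (there (here e)) → there (there (here e))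
    ; (there (there (here e))) → here e }

  -- The marked neighbours of an unmarked vertex are seen by its component, hence lie in a list of
  -- length at most four.
  safe-5 : ∀ {S} → (∀ {C} → Component (_∉ S) C →
                    ∃[ xs ] (length xs ≤ 4 × Within S C xs)) → Safe G 5 S
  safe-5 {S} four v v∉S with component (λ u → ¬? (u ∈? S)) v∉S
  ... | C , v∈C , C-comp with four C-comp
  ... | xs , xs≤4 , wi = s≤s (ℕ.≤-trans
    (p⊆q⇒∣p∣≤∣q∣ λ q∈ → ∈-fromList (wi (p∩q⊆p S _ q∈)
      (v , v∈C , ∈neighbours⇒Adj (p∩q⊆q S (neighbours G v) q∈))))
    (ℕ.≤-trans (∣fromList∣≤length xs) xs≤4))

  -- By `split`, marking `c` creates new components only inside `D`, and these see `c`; the others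
  -- are old and do not.
  advance : ∀ {S D c} → Component (_∉ S) D → c ∈ D →
    (∀ {E} → Component (_∉ S) E → c ∉ E → Few S E) →
    (∀ {B} → Component (_∉ S ▹ c) B → Sees B c → B ⊆ D → Few (S ▹ c) B) →
    AllFew (S ▹ c)
  advance {S} D-comp c∈D outer inner B-comp with split D-comp c∈D B-comp
  ... | inj₁ (Bc , B⊆D)  = inner B-comp Bc B⊆D
  ... | inj₂ (¬Bc , B-comp′) = few-▹ ¬Bc
    (outer B-comp′ λ c∈B → satisfies B-comp c∈B (new {S = S}))

  -- The position after a move by Bob

  -- The same `y` and `z` serve every component, so that two crowded ones share all of `x`, `y`,
  -- `z`.
  AfterBob : Subset n → Fin n → Fin n → Fin n → Fin n → Set
  AfterBob S b x y z = ∀ {E} → Component (_∉ S ▹ b) E →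
    Few (S ▹ b) E ⊎ (Sees E b × Within (S ▹ b) E (b ∷ x ∷ y ∷ z ∷ []))

  after-bob : ∀ {S b x} → AllFew S → b ∉ S → x ∈ S → Adj G b x →
              ∃[ y ] ∃[ z ] AfterBob S b x y z
  after-bob {S} {b} {x} few b∉S x∈S b~x
    with component (λ u → ¬? (u ∈? S)) b∉S
  ... | C , b∈C , C-comp with few C-comp
  ... | _ , _ , _ , wi with bring-front (wi x∈S (b , b∈C , b~x))
  ... | y , z , front = y , z , after
    where
    after : AfterBob S b x y z
    after E-comp with split C-comp b∈C E-comp
    ... | inj₁ (Eb , E⊆C) =
      inj₂ (Eb , within-▹ E⊆C λ q∈S s → front (wi q∈S s))
    ... | inj₂ (¬Eb , E-comp′) = inj₁ (few-▹ ¬Eb (few E-comp′))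

  -- As `y` and `z` come from a possibly padded list, their being marked and distinct has to be
  -- recorded.
  Crowded : Subset n → Fin n → Fin n → Fin n → Subset n → Set
  Crowded S x y z D = (y ∈ S × z ∈ S × x ≢ y × x ≢ z × y ≢ z) ×
                      (Sees D x × Sees D y × Sees D z)

  crowded? : ∀ S x y z D → Dec (Crowded S x y z D)
  crowded? S x y z D =
    (y ∈? S ×-dec z ∈? S ×-dec ¬? (x ≟ y) ×-dec ¬? (x ≟ z) ×-dec ¬? (y ≟ z))
    ×-dec (sees? D x ×-dec sees? D y ×-dec sees? D z)

  few⊎crowded : ∀ {S b x y z D} → x ∈ S →
                Within (S ▹ b) D (b ∷ x ∷ y ∷ z ∷ []) →
                Few (S ▹ b) D ⊎ Crowded S x y z D
  few⊎crowded {S} {b} {x} {y} {z} {D} x∈S wi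
    with sees? D x | y ∈? S ×-dec sees? D y | z ∈? S ×-dec sees? D z
       | x ≟ y | x ≟ z | y ≟ z
  ... | no ¬x | _ | _ | _ | _ | _ = inj₁ (omit wi (here refl) (¬x ∘ proj₂))
  ... | _ | no ¬y | _ | _ | _ | _ = inj₁ (omit wi (there (here refl)) ¬y)
  ... | _ | _ | no ¬z | _ | _ | _ = inj₁ (omit wi (there (there (here refl))) ¬z)
  ... | _ | _ | _ | yes refl | _ | _ = inj₁ (b , x , z , λ q∈ s → merge (wi q∈ s))
    where
    merge : ∀ {q} → q ∈ˡ b ∷ x ∷ x ∷ z ∷ [] → q ∈ˡ b ∷ x ∷ z ∷ []
    merge (here e)          = here e
    merge (there (here e))  = there (here e)
    merge (there (there m)) = there m
  ... | _ | _ | _ | _ | yes refl | _ = inj₁ (b , x , y , λ q∈ s → merge (wi q∈ s))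
    where
    merge : ∀ {q} → q ∈ˡ b ∷ x ∷ y ∷ x ∷ [] → q ∈ˡ b ∷ x ∷ y ∷ []
    merge (here e)                         = here e
    merge (there (here e))                 = there (here e)
    merge (there (there (here e)))         = there (there (here e))
    merge (there (there (there (here e)))) = there (here e)
  ... | _ | _ | _ | _ | _ | yes refl = inj₁ (b , x , y , λ q∈ s → merge (wi q∈ s))
    where
    merge : ∀ {q} → q ∈ˡ b ∷ x ∷ y ∷ y ∷ [] → q ∈ˡ b ∷ x ∷ y ∷ []
    merge (here e)                  = here e
    merge (there (here e))          = there (here e)
    merge (there (there (here e)))  = there (there (here e))
    merge (there (there (there m))) = there (there m)
  ... | yes Dx | yes (y∈S , Dy) | yes (z∈S , Dz) | no x≢y | no x≢z | no y≢z =
    inj₂ ((y∈S , z∈S , x≢y , x≢z , y≢z) , Dx , Dy , Dz)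

  -- Indexed by a vertex of the component, so that the search for a crowded component runs over
  -- vertices and not over subsets.
  CrowdedAt : Subset n → Fin n → Fin n → Fin n → Fin n → Fin n → Set
  CrowdedAt S b x y z v =
    ∃[ D ] (v ∈ D × Component (_∉ S ▹ b) D × Crowded S x y z D)

  crowdedAt? : ∀ S b x y z v → Dec (CrowdedAt S b x y z v)
  crowdedAt? S b x y z v with v ∈? S ▹ b
  ... | yes v∈ = no λ { (_ , v∈D , D-comp , _) → satisfies D-comp v∈D v∈ }
  ... | no  v∉ with component (λ u → ¬? (u ∈? S ▹ b)) v∉
  ... | D , v∈D , D-comp = map′ (λ cr → D , v∈D , D-comp , cr) unique
                             (crowded? S x y z D)
    where
    -- Any component containing `v` lies in `D`, so testing `D` alone decides the question.
    unique : CrowdedAt S b x y z v → Crowded S x y z D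
    unique (D′ , v∈D′ , D′-comp , st , Dx , Dy , Dz) =
      st , sees-⊆ D′⊆D Dx , sees-⊆ D′⊆D Dy , sees-⊆ D′⊆D Dz
      where
      D′⊆D : D′ ⊆ D
      D′⊆D = absorb D-comp (connected D′-comp) (satisfies D′-comp) v∈D′ v∈D

  -- Alice's replies and her strategy

  Reply : Subset n → Set
  Reply S = ∃[ c ] (c ∉ S × (∃[ s ] (s ∈ S × Adj G c s)) × AllFew (S ▹ c))

  module _ (conn : Connected G) (outer : Outerplanar G) where

    -- Connectedness of `G` gives the component of `v` a marked neighbour `s`; a second one, `r`, is
    -- the target passed to `separator`.
    reply-anywhere : ∀ {S v} → InducesConnected G S → Nonempty S → v ∉ S →
                     AllFew S → Reply S
    reply-anywhere {S} {v} S-conn (t , t∈S) v∉S few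
      with component (λ u → ¬? (u ∈? S)) v∉S
    ... | D , v∈D , D-comp
      with leave (conn v t) v∈D (λ t∈D → satisfies D-comp t∈D t∈S)
    ... | w , s , w∈D , s∉D , w~s
      with decidable-stable (s ∈? S) (λ s∉S → s∉D (closed D-comp w∈D s∉S w~s))
    ... | s∈S with any? (λ r → (r ∈? S) ×-dec ¬? (s ≟ r) ×-dec sees? D r)
    -- Here `s` is the only marked neighbour of `D`, so the new components inside `D` see at most
    -- `w` and `s`.
    ... | no ¬r = w , satisfies D-comp w∈D , (s , s∈S , w~s) ,
      advance D-comp w∈D (λ E-comp _ → few E-comp) λ _ _ B⊆D →
        w , s , s , λ q∈ Bq → pad (within-▹ B⊆D only q∈ Bq)
      where
      only : Within S D (s ∷ [])
      only {q} q∈S Dq = here (sym (decidable-stable (s ≟ q) λ s≢q →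
        ¬r (q , q∈S , s≢q , Dq)))
      pad : ∀ {q} → q ∈ˡ w ∷ s ∷ [] → q ∈ˡ w ∷ s ∷ s ∷ []
      pad (here e)         = here e
      pad (there (here e)) = there (here e)
    ... | yes (r , r∈S , s≢r , Dr)
      with separator (proj₁ outer) (proj₂ outer) S-conn D-comp s∈S r∈S s≢r
             (w , w∈D , w~s) Dr
    ... | c , c∈D , c~s , separates =
      c , satisfies D-comp c∈D , (s , s∈S , c~s) ,
      advance D-comp c∈D (λ E-comp _ → few E-comp) inner
      where
      inner : ∀ {B} → Component (_∉ S ▹ c) B → Sees B c → B ⊆ D → Few (S ▹ c) B
      inner B-comp Bc B⊆D =
        few-separated (few D-comp) B⊆D s∈S (w , w∈D , w~s) r∈S Dr
          (separates B-comp Bc B⊆D)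

    reply : ∀ {S b x y z v} → InducesConnected G S → b ∉ S → x ∈ S → Adj G b x →
            AfterBob S b x y z → v ∉ S ▹ b → Reply (S ▹ b)
    reply {S} {b} {x} {y} {z} S-conn b∉S x∈S b~x after v∉
      with any? (crowdedAt? S b x y z)
    ... | no ¬crowded =
      reply-anywhere (connected-▹ S-conn x∈S b~x) (x , old x∈S) v∉ few
      where
      few : AllFew (S ▹ b)
      few E-comp with after E-comp
      ... | inj₁ f = f
      ... | inj₂ (_ , wi) with few⊎crowded x∈S wi
      ... | inj₁ f  = f
      ... | inj₂ cr = contradiction
        (_ , _ , proj₂ (nonempty E-comp) , E-comp , cr) ¬crowded
    ... | yes (_ , D , _ , D-comp , (y∈S , z∈S , x≢y , x≢z , y≢z) , Dx , Dy , Dz)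
      -- Choosing `c` next to `x` pays twice: `separator` parts `x` from `y`, and `b`, `c` become
      -- twins at `x` for `¬beyond-twins`.
      with separator (proj₁ outer) (proj₂ outer) (connected-▹ S-conn x∈S b~x)
             D-comp (old x∈S) (old y∈S) x≢y Dx Dy
    ... | c , c∈D , c~x , separates =
      c , satisfies D-comp c∈D , (x , old x∈S , c~x) ,
      advance D-comp c∈D others inner
      where
      others : ∀ {E} → Component (_∉ S ▹ b) E → c ∉ E → Few (S ▹ b) E
      others {E} E-comp c∉E with after E-comp
      ... | inj₁ f = f
      ... | inj₂ (_ , wi) with few⊎crowded x∈S wi
      ... | inj₁ f = f
      -- `E` is disjoint from `D`: if they met, `E` would absorb `D` and contain `c`.
      ... | inj₂ (_ , Ex , Ey , Ez) = contradiction Ez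
        (¬three-common (proj₁ outer) (proj₂ outer) D-comp E-comp
          (λ v∈D v∈E → c∉E (absorb E-comp (connected D-comp)
                                   (satisfies D-comp) v∈D v∈E c∈D))
          (old x∈S) (old y∈S) (old z∈S) x≢y x≢z y≢z Dx Dy Dz Ex Ey)

      inner : ∀ {B} → Component (_∉ S ▹ b ▹ c) B → Sees B c → B ⊆ D →
              Few (S ▹ b ▹ c) B
      inner {B} B-comp Bc B⊆D with after D-comp
      ... | inj₁ few-D = few-separated few-D B⊆D (old x∈S) Dx (old y∈S) Dy
                           (separates B-comp Bc B⊆D)
      -- Of the five candidates `c`, `b`, `x`, `y`, `z` two must go: `y` and `z` if `B` sees `b`;
      -- `b` and `y` if it sees only `x` of the pair `b`, `x`; else `b` and `x`.
      ... | inj₂ (_ , wi) with sees? B b | sees? B x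
      ... | yes Bb | _ = c , b , x , λ q∈ Bq → keep (within-▹ B⊆D wi q∈ Bq) Bq
        where
        beyond : ∀ {r} → r ∈ S → x ≢ r → ¬ Sees B r
        beyond r∈S x≢r =
          ¬beyond-twins (proj₁ outer) (proj₂ outer) S-conn x∈S r∈S x≢r b∉S
            (satisfies D-comp c∈D) b~x c~x B-comp Bb Bc
        keep : ∀ {q} → q ∈ˡ c ∷ b ∷ x ∷ y ∷ z ∷ [] → Sees B q →
               q ∈ˡ c ∷ b ∷ x ∷ []
        keep (here e)                  _ = here e
        keep (there (here e))          _ = there (here e)
        keep (there (there (here e)))  _ = there (there (here e))
        keep (there (there (there (here refl)))) By =
          contradiction By (beyond y∈S x≢y)
        keep (there (there (there (there (here refl))))) Bz =
          contradiction Bz (beyond z∈S x≢z)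
      ... | no ¬Bb | yes Bx = c , x , z ,
          λ q∈ Bq → keep (within-▹ B⊆D wi q∈ Bq) Bq
        where
        keep : ∀ {q} → q ∈ˡ c ∷ b ∷ x ∷ y ∷ z ∷ [] → Sees B q →
               q ∈ˡ c ∷ x ∷ z ∷ []
        keep (here e)                            _  = here e
        keep (there (here refl))                 Bb = contradiction Bb ¬Bb
        keep (there (there (here e)))            _  = there (here e)
        keep (there (there (there (here refl)))) By =
          contradiction By (separates B-comp Bc B⊆D Bx)
        keep (there (there (there (there m))))   _  = there (there m)
      ... | no ¬Bb | no ¬Bx = c , y , z ,
          λ q∈ Bq → keep (within-▹ B⊆D wi q∈ Bq) Bq
        where
        keep : ∀ {q} → q ∈ˡ c ∷ b ∷ x ∷ y ∷ z ∷ [] → Sees B q →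
               q ∈ˡ c ∷ y ∷ z ∷ []
        keep (here e)                          _  = here e
        keep (there (here refl))               Bb = contradiction Bb ¬Bb
        keep (there (there (here refl)))       Bx = contradiction Bx ¬Bx
        keep (there (there (there m)))         _  = there m

    -- Each round enlarges the marked set, which justifies the recursion; connectedness of `S` is
    -- carried along for the minors that use it.
    play : ∀ {S} → Acc _⊃_ S → InducesConnected G S → Nonempty S → AllFew S →
           Strategy G 5 bob S
    play {S} (acc rec) S-conn S≠∅ few = bobMoves (safe-5 (few⇒four ∘ few)) answer
      where
      answer : ∀ b → Legal G S b → Strategy G 5 alice (S ▹ b)
      answer b (_   , inj₁ S=∅) = contradiction S≠∅ S=∅
      answer b (b∉S , inj₂ (x , x∈S , b~x)) with after-bob few b∉S x∈S b~x
      ... | y , z , after with all? (_∈? S ▹ b)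
      ... | yes full = finished safe full
        where safe = λ v v∉ → contradiction (full v) v∉
      ... | no ¬full with ¬∀⟶∃¬ n _ (_∈? S ▹ b) ¬full
      ... | v , v∉ with reply S-conn b∉S x∈S b~x after v∉
      ... | c , c∉ , (s , s∈ , c~s) , few′ =
        -- Before Alice answers, a component may have a fourth marked neighbour `b`; the bound 5
        -- allows exactly this.
        aliceMove (safe-5 four) c (c∉ , inj₂ (s , s∈ , c~s))
          (play (rec (⊂-trans (▹-⊃ b∉S) (▹-⊃ c∉)))
            (connected-▹ (connected-▹ S-conn x∈S b~x) s∈ c~s)
            (c , new {S = S ▹ b}) few′)
        where
        four : ∀ {E} → Component (_∉ S ▹ b) E →
               ∃[ xs ] (length xs ≤ 4 × Within (S ▹ b) E xs)
        four E-comp with after E-comp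
        ... | inj₁ f        = few⇒four f
        ... | inj₂ (_ , wi) = b ∷ x ∷ y ∷ z ∷ [] , ℕ.≤-refl , wi

    alice-wins : Fin n → AliceWins G 5
    alice-wins v =
      aliceMove (safe-5 λ _ → [] , z≤n , λ q∈⊥ → contradiction q∈⊥ ∉⊥)
        v (∉⊥ , inj₁ λ { (_ , q∈⊥) → ∉⊥ q∈⊥ })
        (play (⊃-wellFounded _)
          -- The position after the first move is `⊥ ▹ v`, equal to the singleton only
          -- propositionally.
          (subst (InducesConnected G) (sym (∪-identityˡ ⁅ v ⁆)) (connected-⁅⁆ v))
          (v , new {S = ⊥}) λ _ → v , v , v , λ q∈ _ → only q∈)
      where
      only : ∀ {q} → q ∈ ⊥ ▹ v → q ∈ˡ v ∷ v ∷ v ∷ []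
      only q∈ with old⊎new {S = ⊥} q∈
      ... | inj₁ q∈⊥ = contradiction q∈⊥ ∉⊥
      ... | inj₂ q≡v = here q≡v

theorem7 : ∀ (n : ℕ) .{{_ : NonZero n}} (G : Graph n) (connected : Connected G) →
    Outerplanar G → col-cg G connected ≤ 5
theorem7 (suc n) G connected outer =
  proj₂ (col-cg-least G connected) 5 (alice-wins G connected outer zero)
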